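{- Consider the optimal stopping problem for independent random variables $X_1,\dots,X_n$ with known distributions $\mathcal{D}_1,\dots,\mathcal{D}_n$. Whenever there is no commitment and no observation (opening) cost, the best ratio between the gambler and the prophet is $1$. This holds in both the maximization and the minimization version, and both with order selection and without it. That is, in the maximization version the best expected reward that the gambler can achieve equals the prophet's, $\mathbb{E}[\max_{i\in[n]}X_i]$. In the minimization version the best expected cost that the gambler can achieve equals the prophet's, $\mathbb{E}[\min_{i\in[n]}X_i]$.
   Context: A gambler inspects the variables one at a time. Each inspection reveals the realized value of one variable. With order selection, the gambler chooses the inspection order; without order selection, the order is presented to her adversarially. The gambler may stop at any time after inspecting at least one variable, and her decisions are based only on the distributions and the values revealed so far. No commitment: upon stopping, the gambler may select any variable inspected so far, not only the last one. No observation cost: inspecting a variable is free. The selected value is the gambler's reward in the maximization version and her cost in the minimization version. The prophet knows all realized values in advance. With no commitment and no observation cost, the prophet obtains $\mathbb{E}[\max_{i\in[n]}X_i]$ in the maximization version and pays $\mathbb{E}[\min_{i\in[n]}X_i]$ in the minimization version. The distributions are such that these expectations are defined. -}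

module Defs where

open import Algebra.Bundles using (RawMonoid)
open import Algebra.Definitions.RawMonoid using (sum)
open import Algebra.Structures using (IsCommutativeRing)
import Algebra.Construct.NaturalChoice.Max as Max
open import Data.Fin.Base using (Fin; zero; suc; toℕ)
open import Data.List.Base as List using (List; []; _∷_)
import Data.List.Extrema as Extrema
open import Data.List.Membership.Propositional using (_∈_; _∉_)
open import Data.Nat.Base using (ℕ; suc)
open import Data.Product.Base using (∃; _×_; _,_; proj₁)
open import Function.Base using (_∘_)
open import Level using (0ℓ) renaming (suc to lsuc; _⊔_ to _⊔ˡ_)
open import Relation.Binary.Bundles using (TotalOrder)
open import Relation.Binary.Core using (Rel)
import Relation.Binary.Construct.Add.Extrema.NonStrict as AddExtrema
open import Relation.Binary.PropositionalEquality.Core using (_≡_; _≢_)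
open import Relation.Binary.Structures using (IsTotalOrder)
open import Relation.Nullary.Construct.Add.Extrema using (_±; ⊥±; ⊤±; [_])
open import Relation.Unary using (Pred; Satisfiable; ∁; U; ⋃; _≐_; _⊥_; _⊢_)

IsSup : ∀ {a ℓ s} {A : Set a} → Rel A ℓ → Pred A s → A → Set (a ⊔ˡ ℓ ⊔ˡ s)
IsSup _≤_ S v = (∀ x → S x → x ≤ v) × (∀ u → (∀ x → S x → x ≤ u) → v ≤ u)

-- The real numbers, given axiomatically as a Dedekind-complete ordered field
-- (classically unique up to isomorphism).
record Reals : Set₂ where
  infix  4 _≤_
  infixl 6 _+_
  infixl 7 _*_
  infix  8 -_
  field
    ℝ       : Set
    _≤_     : Rel ℝ 0ℓ
    _+_ _*_ : ℝ → ℝ → ℝ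
    -_      : ℝ → ℝ
    0# 1#   : ℝ
    isCommutativeRing : IsCommutativeRing _≡_ _+_ _*_ -_ 0# 1#
    0≢1               : 0# ≢ 1#
    inverse           : ∀ x → x ≢ 0# → ∃ λ y → x * y ≡ 1#
    isTotalOrder      : IsTotalOrder _≡_ _≤_
    +-monoˡ-≤         : ∀ {x y} z → x ≤ y → x + z ≤ y + z
    *-nonNegative     : ∀ {x y} → 0# ≤ x → 0# ≤ y → 0# ≤ x * y
    complete          : (S : Pred ℝ (lsuc 0ℓ)) → Satisfiable S →
                        (∃ λ u → ∀ x → S x → x ≤ u) → ∃ (IsSup _≤_ S)

record IsσAlgebra {Ω : Set} (Event : Pred Ω 0ℓ → Set₁) : Set₁ where
  field
    resp-≐   : ∀ {A B} → A ≐ B → Event A → Event B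
    U-event  : Event U
    ∁-closed : ∀ {A} → Event A → Event (∁ A)
    ⋃-closed : ∀ {A : ℕ → Pred Ω 0ℓ} → (∀ k → Event (A k)) → Event (⋃ ℕ A)

module Stopping (R : Reals) where

  open Reals R

  ≤-totalOrder : TotalOrder 0ℓ 0ℓ 0ℓ
  ≤-totalOrder = record { isTotalOrder = isTotalOrder }

  open Max ≤-totalOrder public using (_⊔_)
  open AddExtrema _≤_ public using (_≤±_)

  +-0-rawMonoid *-1-rawMonoid : RawMonoid 0ℓ 0ℓ
  +-0-rawMonoid = record { Carrier = ℝ ; _≈_ = _≡_ ; _∙_ = _+_ ; ε = 0# }
  *-1-rawMonoid = record { Carrier = ℝ ; _≈_ = _≡_ ; _∙_ = _*_ ; ε = 1# }

  Σ[_] Π[_] : ∀ {n} → (Fin n → ℝ) → ℝ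
  Σ[_] = sum +-0-rawMonoid
  Π[_] = sum *-1-rawMonoid

  maximum minimum : ∀ {n} → (Fin (suc n) → ℝ) → ℝ
  maximum x = Extrema.max ≤-totalOrder (x zero) (List.tabulate (x ∘ suc))
  minimum x = Extrema.min ≤-totalOrder (x zero) (List.tabulate (x ∘ suc))

  ----------------------------------------------------------------------
  -- Probability

  data Borel : Pred ℝ 0ℓ → Set₁ where
    ray        : ∀ t → Borel (_≤ t)
    resp       : ∀ {A B} → A ≐ B → Borel A → Borel B
    full       : Borel U
    complement : ∀ {A} → Borel A → Borel (∁ A)
    union      : ∀ {A : ℕ → Pred ℝ 0ℓ} → (∀ k → Borel (A k)) → Borel (⋃ ℕ A)

  record ProbabilityMeasure {Ω : Set} (Event : Pred Ω 0ℓ → Set₁) : Set₁ where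
    field
      P         : (A : Pred Ω 0ℓ) → Event A → ℝ
      P-resp-≐  : ∀ {A B} → A ≐ B → (a : Event A) (b : Event B) → P A a ≡ P B b
      P-nonNeg  : ∀ {A} (a : Event A) → 0# ≤ P A a
      P-total   : (u : Event U) → P U u ≡ 1#
      -- The terms are nonnegative, so the sum of the series is the supremum of
      -- the partial sums.
      P-countablyAdditive :
        ∀ {A : ℕ → Pred Ω 0ℓ} (a : ∀ k → Event (A k)) →
        (∀ {j k} → j ≢ k → A j ⊥ A k) → (⋃a : Event (⋃ ℕ A)) →
        IsSup _≤_
          (λ s → ∃ λ m → s ≡ Σ[ (λ (k : Fin m) → P (A (toℕ k)) (a (toℕ k))) ])
          (P (⋃ ℕ A) ⋃a)

  Distribution : Set₁
  Distribution = ProbabilityMeasure Borel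

  record ProbabilitySpace : Set₂ where
    field
      Ω          : Set
      Event      : Pred Ω 0ℓ → Set₁
      isσAlgebra : IsσAlgebra Event
      measure    : ProbabilityMeasure Event
    open ProbabilityMeasure measure public

  module _ (𝓟 : ProbabilitySpace) where

    open ProbabilitySpace 𝓟

    IsMeasurable : (Ω → ℝ) → Set₁
    IsMeasurable f = ∀ B → Borel B → Event (f ⊢ B)

    record RandomVariable : Set₁ where
      field
        value      : Ω → ℝ
        measurable : IsMeasurable value

    open RandomVariable

    HasDistribution : RandomVariable → Distribution → Set₁
    HasDistribution X 𝓓 = ∀ B (b : Borel B) →
      P (value X ⊢ B) (measurable X B b) ≡ ProbabilityMeasure.P 𝓓 B b

    Independent : ∀ {n} → (Fin n → RandomVariable) → Set₁
    Independent {n} X =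
      ∀ (B : Fin n → Pred ℝ 0ℓ) (b : ∀ i → Borel (B i)) →
      (e : Event (λ ω → ∀ i → B i (value (X i) ω))) →
      P _ e ≡ Π[ (λ i → P (value (X i) ⊢ B i) (measurable (X i) (B i) (b i))) ]

    -- The simple function ω ↦ coeff (label ω).
    record Simple : Set₁ where
      field
        {size}       : ℕ
        label        : Ω → Fin size
        label-event  : ∀ i → Event (λ ω → label ω ≡ i)
        coeff        : Fin size → ℝ
        coeff-nonNeg : ∀ i → 0# ≤ coeff i

      integral : ℝ
      integral = Σ[ (λ i → coeff i * P _ (label-event i)) ]

    open Simple

    -- The Lebesgue integral of a nonnegative f, with values in [0, ∞].
    IsIntegral⁺ : (Ω → ℝ) → ℝ ± → Set₁
    IsIntegral⁺ f = IsSup _≤±_ λ v → ∃ λ s →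
      (∀ ω → coeff s (label s ω) ≤ f ω) × v ≡ [ integral s ]

    -- c = a - b for a, b ∈ [0, ∞]; ∞ - ∞ is undefined.
    data IsDifference : (a b c : ℝ ±) → Set where
      finite : ∀ a b → IsDifference [ a ] [ b ] [ a + - b ]
      plus∞  : ∀ b → IsDifference ⊤± [ b ] ⊤±
      minus∞ : ∀ a → IsDifference [ a ] ⊤± ⊥±

    -- 𝔼[ f ] is defined and equals e, possibly ±∞.
    HasExpectation : (Ω → ℝ) → ℝ ± → Set₁
    HasExpectation f e = IsMeasurable f × ∃ λ a → ∃ λ b →
      IsIntegral⁺ (λ ω → f ω ⊔ 0#) a ×
      IsIntegral⁺ (λ ω → (- f ω) ⊔ 0#) b ×
      IsDifference a b e

  ----------------------------------------------------------------------
  -- Gamblers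

  -- A gambler choosing her own inspection order, as a decision tree branching
  -- on the revealed values; the list holds the variables inspected so far.
  -- Initially it is empty, so stopping requires at least one inspection.
  data OrderingGambler {n : ℕ} (seen : List (Fin n)) : Set where
    stop    : ∀ i → i ∈ seen → OrderingGambler seen
    inspect : ∀ i → i ∉ seen → (ℝ → OrderingGambler (i ∷ seen)) →
              OrderingGambler seen

  -- The index of the selected variable when the realized values are x.
  selectOrdering : ∀ {n} {seen : List (Fin n)} →
                   OrderingGambler seen → (Fin n → ℝ) → Fin n
  selectOrdering (stop i _)      x = i
  selectOrdering (inspect i _ k) x = selectOrdering (k (x i)) x

  -- A gambler not choosing the order can only ask for another variable, while
  -- one is left, and is then told which variable it is and its value.
  data Gambler {n : ℕ} (seen : List (Fin n)) : Set where
    stop     : ∀ i → i ∈ seen → Gambler seen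
    continue : ∃ (_∉ seen) → (∀ i → i ∉ seen → ℝ → Gambler (i ∷ seen)) →
               Gambler seen

  History : ℕ → Set
  History n = List (Fin n × ℝ)

  inspected : ∀ {n} → History n → List (Fin n)
  inspected = List.map proj₁

  -- The adversary presents some variable not yet inspected, as long as there
  -- is one. The choice may depend on the past; orders fixed in advance are the
  -- special case where it depends on the inspected indices only.
  Adversary : ℕ → Set
  Adversary n = (h : History n) → ∃ (_∉ inspected h) → ∃ (_∉ inspected h)

  select : ∀ {n} (h : History n) → Gambler (inspected h) → Adversary n →
           (Fin n → ℝ) → Fin n
  select h (stop i _)        σ x = i
  select h (continue more k) σ x with σ h more
  ... | i , i∉ = select ((i , x i) ∷ h) (k i i∉ (x i)) σ x

  module _ (𝓟 : ProbabilitySpace) {n : ℕ} (X : Fin n → RandomVariable 𝓟) where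

    open ProbabilitySpace 𝓟 using (Ω)

    realized : Ω → Fin n → ℝ
    realized ω i = RandomVariable.value (X i) ω

    payoffOrdering : OrderingGambler {n} [] → Ω → ℝ
    payoffOrdering g ω = realized ω (selectOrdering g (realized ω))

    payoff : Gambler {n} [] → Adversary n → Ω → ℝ
    payoff g σ ω = realized ω (select [] g σ (realized ω))

    -- Below, v ≼ e reads "e is at least as good as v": ≤ for rewards, ≥ for
    -- costs.

    IsBestWithOrderSelection : Rel (ℝ ±) 0ℓ → ℝ ± → Set₁
    IsBestWithOrderSelection _≼_ e =
      (∃ λ g → HasExpectation 𝓟 (payoffOrdering g) e) ×
      (∀ g v → HasExpectation 𝓟 (payoffOrdering g) v → v ≼ e)

    -- The gambler attains e against every adversary, with one strategy not
    -- knowing the adversary, and against no adversary can she do better, even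
    -- with a strategy tailored to him.
    IsBestWithoutOrderSelection : Rel (ℝ ±) 0ℓ → ℝ ± → Set₁
    IsBestWithoutOrderSelection _≼_ e =
      (∃ λ g → ∀ σ → HasExpectation 𝓟 (payoff g σ) e) ×
      (∀ g σ v → HasExpectation 𝓟 (payoff g σ) v → v ≼ e)

{-# OPTIONS --safe #-}
module Submission where

open import Algebra.Bundles using (AbelianGroup)
import Algebra.Construct.NaturalChoice.Max as Max
import Algebra.Properties.AbelianGroup as AbelianGroupProperties
open import Algebra.Structures using (IsCommutativeRing)
open import Data.Fin.Base using (Fin; zero; suc)
open import Data.Fin.Properties using (_≟_; any?)
open import Data.Fin.Subset using (Subset; ⊤; _-_; _⊂_) renaming (_∈_ to _∈ˢ_)
open import Data.Fin.Subset.Induction using (⊂-wellFounded)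
open import Data.Fin.Subset.Properties using (∈⊤; x∈p∧x≢y⇒x∈p-y; x∈p⇒p-x⊂p)
open import Data.List.Base using (List; []; _∷_; foldr; tabulate)
import Data.List.Extrema as Extrema
import Data.List.Membership.DecPropositional as DecMembership
open import Data.List.Membership.Propositional using (_∈_; _∉_)
open import Data.List.Membership.Propositional.Properties using (∈-map⁺; ∈-map⁻)
open import Data.List.Relation.Unary.All as All using (All; []; _∷_)
import Data.List.Relation.Unary.All.Properties as All
open import Data.List.Relation.Unary.Any using (here; there)
open import Data.List.Relation.Unary.Any.Properties using (¬Any[])
open import Data.Nat.Base using (ℕ; suc)
open import Data.Product.Base using (∃; _×_; _,_; proj₁; proj₂)
open import Defs
open import Function.Base using (flip; _∘_)
open import Induction.WellFounded using (Acc; acc)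
open import Level using (0ℓ)
open import Relation.Binary.Bundles using (TotalOrder)
import Relation.Binary.Construct.Add.Extrema.NonStrict as AddExtrema
import Relation.Binary.Construct.Flip.EqAndOrd as Flip
open import Relation.Binary.Core using (Rel)
open import Relation.Binary.PropositionalEquality
  using (_≡_; refl; sym; trans; cong; subst; subst₂)
open import Relation.Binary.Structures using (IsTotalOrder)
open import Relation.Nullary using (¬_; ¬?; Dec; yes; no)
open import Relation.Nullary.Construct.Add.Extrema using (_±)
open import Relation.Nullary.Decidable using (decidable-stable)

-- Since stopping late is free and any inspected variable may be selected, the
-- gambler inspects everything and selects the best variable: her payoff is the
-- prophet's, pointwise. Conversely every gambler's payoff is the value of some
-- variable, so the prophet's payoff bounds it pointwise, and expectations are
-- monotone.

-- Uninspected indices as a termination measure.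

unseen : ∀ {n} → List (Fin n) → Subset n
unseen = foldr (λ i p → p - i) ⊤

∉⇒∈-unseen : ∀ {n} {i : Fin n} seen → i ∉ seen → i ∈ˢ unseen seen
∉⇒∈-unseen []         i∉ = ∈⊤
∉⇒∈-unseen (j ∷ seen) i∉ =
  x∈p∧x≢y⇒x∈p-y (∉⇒∈-unseen seen (i∉ ∘ there)) (i∉ ∘ here)

-- Deleting a member shrinks a subset strictly, so each inspection descends in the well-founded
-- order `_⊂_`. This drives the recursion of `inspectAllFrom`.
unseen-∷-⊂ : ∀ {n} {i : Fin n} seen → i ∉ seen → unseen (i ∷ seen) ⊂ unseen seen
unseen-∷-⊂ seen i∉ = x∈p⇒p-x⊂p (∉⇒∈-unseen seen i∉)

some∉? : ∀ {n} (seen : List (Fin n)) → Dec (∃ (_∉ seen))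
some∉? seen = any? λ i → ¬? (DecMembership._∈?_ _≟_ i seen)

none∉⇒∈ : ∀ {n} (seen : List (Fin n)) → ¬ ∃ (_∉ seen) → ∀ i → i ∈ seen
none∉⇒∈ seen none i =
  decidable-stable (DecMembership._∈?_ _≟_ i seen) λ i∉ → none (i , i∉)

module _ (R : Reals) where

  open Reals R
  open Stopping R
  open IsTotalOrder isTotalOrder using () renaming (trans to ≤-trans)

  -- Order and differences in the extended reals.

  -‿anti-≤ : ∀ {x y} → x ≤ y → - y ≤ - x
  -- Translate `x ≤ y` by `- x + - y` and cancel on both sides.
  -‿anti-≤ {x} {y} x≤y = subst₂ _≤_
    (\\-leftDividesˡ x (- y))
    (trans (cong (y +_) (+-comm (- x) (- y))) (\\-leftDividesˡ y (- x)))
    (+-monoˡ-≤ (- x + - y) x≤y)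
    where
    open IsCommutativeRing isCommutativeRing using (+-comm; +-isAbelianGroup)
    +-abelianGroup : AbelianGroup 0ℓ 0ℓ
    +-abelianGroup = record { isAbelianGroup = +-isAbelianGroup }
    open AbelianGroupProperties +-abelianGroup using (\\-leftDividesˡ)

  difference-mono-≤ : ∀ {a b c d} → a ≤ c → d ≤ b → a + - b ≤ c + - d
  difference-mono-≤ {b = b} {c} {d} a≤c d≤b = ≤-trans (+-monoˡ-≤ (- b) a≤c)
    (subst₂ _≤_ (+-comm (- b) c) (+-comm (- d) c) (+-monoˡ-≤ c (-‿anti-≤ d≤b)))
    where open IsCommutativeRing isCommutativeRing using (+-comm)

  -- Only two finite differences call for arithmetic. A left difference `⊥±` or a right difference
  -- `⊤±` is trivial, and every other combination would put `⊤±` below a finite value.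
  IsDifference-mono : ∀ {𝓟 a b c a′ b′ c′} →
    IsDifference 𝓟 a b c → IsDifference 𝓟 a′ b′ c′ →
    a ≤± a′ → b′ ≤± b → c ≤± c′
  IsDifference-mono (finite _ _) (finite _ _) a≤a′ b′≤b =
    [ difference-mono-≤ ([≤]-injective a≤a′) ([≤]-injective b′≤b) ]
    where
    open AddExtrema _≤_ using ([≤]-injective; [_])
  IsDifference-mono (minus∞ _) q _ _ = AddExtrema.≤±-minimum _≤_ _
  IsDifference-mono _ (plus∞ _) _ _ = AddExtrema.≤±-maximum _≤_ _
  IsDifference-mono (finite _ _) (minus∞ _) _ ()
  IsDifference-mono (plus∞ _) (minus∞ _) _ ()
  IsDifference-mono (plus∞ _) (finite _ _) ()

  -- Monotonicity of integral and expectation.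

  module _ {𝓟 : ProbabilitySpace} where

    open ProbabilitySpace 𝓟
    open IsσAlgebra isσAlgebra using (resp-≐)

    -- A simple function below `f` is also below `g`, so the supremum for `g` bounds all those for
    -- `f`.
    IsIntegral⁺-mono : ∀ {f g a b} → (∀ ω → f ω ≤ g ω) →
                       IsIntegral⁺ 𝓟 f a → IsIntegral⁺ 𝓟 g b → a ≤± b
    IsIntegral⁺-mono {b = b} f≤g (_ , least) (upper , _) =
      least b λ v (s , s≤f , v≡) →
        upper v (s , (λ ω → ≤-trans (s≤f ω) (f≤g ω)) , v≡)

    IsIntegral⁺-resp : ∀ {f g a} → (∀ ω → f ω ≡ g ω) →
                       IsIntegral⁺ 𝓟 f a → IsIntegral⁺ 𝓟 g a
    IsIntegral⁺-resp f≗g (upper , least) =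
      (λ v (s , s≤g , v≡) →
         upper v (s , (λ ω → subst (_ ≤_) (sym (f≗g ω)) (s≤g ω)) , v≡)) ,
      (λ u bound → least u λ v (s , s≤f , v≡) →
         bound v (s , (λ ω → subst (_ ≤_) (f≗g ω) (s≤f ω)) , v≡))

    -- Positive parts keep the order and negative parts reverse it, as `IsDifference-mono` requires.
    HasExpectation-mono : ∀ {f g a b} → (∀ ω → f ω ≤ g ω) →
                          HasExpectation 𝓟 f a → HasExpectation 𝓟 g b → a ≤± b
    HasExpectation-mono f≤g (_ , _ , _ , f⁺ , f⁻ , f-diff)
                            (_ , _ , _ , g⁺ , g⁻ , g-diff) =
      IsDifference-mono {𝓟} f-diff g-diff
        (IsIntegral⁺-mono (λ ω → ⊔-monoˡ-≤ 0# (f≤g ω)) f⁺ g⁺)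
        (IsIntegral⁺-mono (λ ω → ⊔-monoˡ-≤ 0# (-‿anti-≤ (f≤g ω))) g⁻ f⁻)
      where open Max ≤-totalOrder using (⊔-monoˡ-≤)

    -- Payoffs agree with the prophet's value only pointwise. Transporting along that agreement also
    -- yields their measurability, since preimages under `f` and `g` are equivalent events.
    HasExpectation-resp : ∀ {f g e} → (∀ ω → f ω ≡ g ω) →
                          HasExpectation 𝓟 f e → HasExpectation 𝓟 g e
    HasExpectation-resp f≗g (f-meas , a , b , f⁺ , f⁻ , f-diff) =
      (λ B bor → resp-≐ ((λ {ω} → subst B (f≗g ω)) ,
                         (λ {ω} → subst B (sym (f≗g ω))))
                        (f-meas B bor)) ,
      a , b ,
      IsIntegral⁺-resp (λ ω → cong (_⊔ 0#) (f≗g ω)) f⁺ ,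
      IsIntegral⁺-resp (λ ω → cong (λ r → - r ⊔ 0#) (f≗g ω)) f⁻ ,
      f-diff

  -- Playing against a known adversary.

  follow : ∀ {n} (h : History n) → Gambler (inspected h) → Adversary n →
           OrderingGambler (inspected h)
  follow h (stop i i∈)       σ = stop i i∈
  follow h (continue more k) σ with σ h more
  -- The choice of `σ` depends only on the history, which a gambler choosing her own order also
  -- knows, so she can make that choice herself.
  ... | i , i∉ = inspect i i∉ λ v → follow ((i , v) ∷ h) (k i i∉ v) σ

  selectOrdering-follow : ∀ {n} (h : History n) g σ x →
                          selectOrdering (follow h g σ) x ≡ select h g σ x
  selectOrdering-follow h (stop i i∈)       σ x = refl
  selectOrdering-follow h (continue more k) σ x with σ h more
  ... | i , i∉ = selectOrdering-follow ((i , x i) ∷ h) (k i i∉ (x i)) σ x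

  -- Exhaustive inspection, for an order `_≼_` that is `_≤_` for rewards and its converse for costs.

  module _ {_≼_ : Rel ℝ 0ℓ} (≼-isTotalOrder : IsTotalOrder _≡_ _≼_) where

    private
      ≼-totalOrder : TotalOrder 0ℓ 0ℓ 0ℓ
      ≼-totalOrder = record { isTotalOrder = ≼-isTotalOrder }

      module ≼ = TotalOrder ≼-totalOrder

    open Extrema ≼-totalOrder
      using (argmax; argmax-all; f[⊥]≤f[argmax]; f[xs]≤f[argmax])

    argmax∈ : ∀ {n} p (h : History n) → argmax proj₂ p h ∈ p ∷ h
    argmax∈ p h = argmax-all proj₂ {P = _∈ p ∷ h} (here refl) (All.tabulate there)

    -- The latest observation `p` is kept apart from `h` so that the history is visibly nonempty and
    -- `argmax` has a default that was actually observed.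
    inspectAllFrom : ∀ {n} p (h : History n) →
                     Acc _⊂_ (unseen (inspected (p ∷ h))) →
                     Gambler (inspected (p ∷ h))
    inspectAllFrom p h (acc rec) with some∉? (inspected (p ∷ h))
    ... | yes more = continue more λ i i∉ v → inspectAllFrom (i , v) (p ∷ h)
                       (rec (unseen-∷-⊂ (inspected (p ∷ h)) i∉))
    ... | no _     = stop (proj₁ (argmax proj₂ p h)) (∈-map⁺ proj₁ (argmax∈ p h))

    -- The invariant `revealed` ties the recorded values to `x`. Once no index is left, each `i`
    -- occurs in the history, where `argmax` dominates its recorded value.
    inspectAllFrom-best : ∀ {n} p (h : History n) a σ (x : Fin n → ℝ) →
      All (λ (i , v) → x i ≡ v) (p ∷ h) →
      ∀ i → x i ≼ x (select (p ∷ h) (inspectAllFrom p h a) σ x)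
    inspectAllFrom-best p h (acc rec) σ x revealed i with some∉? (inspected (p ∷ h))
    ... | yes more with σ (p ∷ h) more
    ...   | j , j∉ = inspectAllFrom-best (j , x j) (p ∷ h)
              (rec (unseen-∷-⊂ (inspected (p ∷ h)) j∉)) σ x (refl ∷ revealed) i
    inspectAllFrom-best p h (acc rec) σ x revealed i | no none
      with ∈-map⁻ proj₁ (none∉⇒∈ (inspected (p ∷ h)) none i)
    ... | _ , iv∈ , refl = subst₂ _≼_
      (sym (All.lookup revealed iv∈))
      (sym (All.lookup revealed (argmax∈ p h)))
      (All.lookup (f[⊥]≤f[argmax] {f = proj₂} p h ∷ f[xs]≤f[argmax] p h) iv∈)

    inspectAll : ∀ {n} → Gambler {suc n} []
    -- Here `zero` only witnesses that a variable is left; the adversary decides which one is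
    -- presented.
    inspectAll = continue (zero , ¬Any[]) λ i _ v →
      inspectAllFrom (i , v) [] (⊂-wellFounded _)

    inspectAll-best : ∀ {n} σ (x : Fin (suc n) → ℝ) i →
                      x i ≼ x (select [] inspectAll σ x)
    inspectAll-best σ x i with σ [] (zero , ¬Any[])
    ... | j , _ = inspectAllFrom-best (j , x j) [] (⊂-wellFounded _) σ x (refl ∷ []) i

    module _ (𝓟 : ProbabilitySpace) {n : ℕ}
             (X : Fin (suc n) → RandomVariable 𝓟)
             (best : (Fin (suc n) → ℝ) → ℝ)
             (best-upper : ∀ x i → x i ≼ best x)
             (best-least : ∀ x {v} → (∀ i → x i ≼ v) → best x ≼ v)
             (_≼±_ : Rel (ℝ ±) 0ℓ)
             (expectation-mono : ∀ {f g a b} → (∀ ω → f ω ≼ g ω) →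
               HasExpectation 𝓟 f a → HasExpectation 𝓟 g b → a ≼± b)
             {e : ℝ ±}
             (prophet : HasExpectation 𝓟 (λ ω → best (realized 𝓟 X ω)) e)
             where

      private
        -- Antisymmetry: the payoff dominates all values, hence `best`, and is itself one of the
        -- values.
        attained : ∀ σ → HasExpectation 𝓟 (payoff 𝓟 X inspectAll σ) e
        attained σ = HasExpectation-resp {𝓟}
          (λ ω → ≼.antisym (best-least _ (inspectAll-best σ (realized 𝓟 X ω)))
                           (best-upper _ _))
          prophet

      prophet-bestWithOrderSelection : IsBestWithOrderSelection 𝓟 X _≼±_ e
      prophet-bestWithOrderSelection =
        (follow [] inspectAll σ ,
         HasExpectation-resp {𝓟}
           (λ ω → cong (realized 𝓟 X ω)
                       (sym (selectOrdering-follow [] inspectAll σ _)))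
           (attained σ)) ,
        λ g v Ev → expectation-mono (λ ω → best-upper _ _) Ev prophet
        where
        -- Any adversary would do; this one presents the variable exhibited by `more`.
        σ : Adversary (suc n)
        σ _ more = more

      prophet-bestWithoutOrderSelection : IsBestWithoutOrderSelection 𝓟 X _≼±_ e
      prophet-bestWithoutOrderSelection =
        (inspectAll , attained) ,
        λ g σ v Ev → expectation-mono (λ ω → best-upper _ _) Ev prophet

  -- Extremal properties of `maximum` and `minimum`.

  open Extrema ≤-totalOrder
    using (⊥≤max; xs≤max; max≤v⁺; min≤⊤; min≤xs; v≤min⁺)

  ≤-maximum : ∀ {n} (x : Fin (suc n) → ℝ) i → x i ≤ maximum x
  ≤-maximum x zero    = ⊥≤max (x zero) (tabulate (x ∘ suc))
  ≤-maximum x (suc i) = All.tabulate⁻ (xs≤max (x zero) (tabulate (x ∘ suc))) i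

  maximum-least : ∀ {n} (x : Fin (suc n) → ℝ) {v} →
                  (∀ i → x i ≤ v) → maximum x ≤ v
  maximum-least x x≤v = max≤v⁺ (x≤v zero) (All.tabulate⁺ (x≤v ∘ suc))

  minimum-≤ : ∀ {n} (x : Fin (suc n) → ℝ) i → minimum x ≤ x i
  minimum-≤ x zero    = min≤⊤ (x zero) (tabulate (x ∘ suc))
  minimum-≤ x (suc i) = All.tabulate⁻ (min≤xs (x zero) (tabulate (x ∘ suc))) i

  minimum-greatest : ∀ {n} (x : Fin (suc n) → ℝ) {v} →
                     (∀ i → v ≤ x i) → v ≤ minimum x
  minimum-greatest x v≤x = v≤min⁺ (v≤x zero) (All.tabulate⁺ (v≤x ∘ suc))

proposition3p1 : (R : Reals) → let open Stopping R in
    (𝓟 : ProbabilitySpace) (n : ℕ)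
    (𝓓 : Fin (suc n) → Distribution) (X : Fin (suc n) → RandomVariable 𝓟) →
    (∀ i → HasDistribution 𝓟 (X i) (𝓓 i)) →
    Independent 𝓟 X →
    (∀ e → HasExpectation 𝓟 (λ ω → maximum (realized 𝓟 X ω)) e →
    IsBestWithOrderSelection 𝓟 X _≤±_ e ×
    IsBestWithoutOrderSelection 𝓟 X _≤±_ e) ×
    (∀ e → HasExpectation 𝓟 (λ ω → minimum (realized 𝓟 X ω)) e →
    IsBestWithOrderSelection 𝓟 X (flip _≤±_) e ×
    IsBestWithoutOrderSelection 𝓟 X (flip _≤±_) e)
proposition3p1 R 𝓟 n 𝓓 X _ _ =
  (λ e prophet →
    prophet-bestWithOrderSelection R isTotalOrder 𝓟 X maximum
      (≤-maximum R) (maximum-least R) _≤±_ (HasExpectation-mono R {𝓟}) prophet ,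
    prophet-bestWithoutOrderSelection R isTotalOrder 𝓟 X maximum
      (≤-maximum R) (maximum-least R) _≤±_ (HasExpectation-mono R {𝓟}) prophet) ,
  (λ e prophet →
    -- In the reversed order `minimum` is the least upper bound, so the same argument settles costs.
    prophet-bestWithOrderSelection R ≥-isTotalOrder 𝓟 X minimum
      (minimum-≤ R) (minimum-greatest R) (flip _≤±_) expectation-anti prophet ,
    prophet-bestWithoutOrderSelection R ≥-isTotalOrder 𝓟 X minimum
      (minimum-≤ R) (minimum-greatest R) (flip _≤±_) expectation-anti prophet)
  where
  open Reals R using (_≤_; isTotalOrder)
  open Stopping R

  ≥-isTotalOrder : IsTotalOrder _≡_ (flip _≤_)
  ≥-isTotalOrder = Flip.isTotalOrder isTotalOrder

  expectation-anti : ∀ {f g a b} → (∀ ω → g ω ≤ f ω) →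
    HasExpectation 𝓟 f a → HasExpectation 𝓟 g b → b ≤± a
  expectation-anti g≤f Ef Eg = HasExpectation-mono R {𝓟} g≤f Eg Ef
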